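{- Let $r,t$ be integers with $2\le r-1\le t$. Then $\mathrm{cov}(r,r+t)\le t+2$.
   Context: A complete $r$-uniform $r$-partite hypergraph $K$ has a vertex set $V=V(K)$ partitioned into nonempty classes $V_1\cup\dots\cup V_r$, and its edges are exactly the sets containing one vertex from each class. A $k$-coloring of a hypergraph is an assignment of a color from $[k]=\{1,\dots,k\}$ to each edge (not all $k$ colors need be used). A coloring is spanning if every vertex is incident to edges of every color used in the coloring. For an edge-colored hypergraph $H$, let $H_i$ be the subhypergraph on vertex set $V(H)$ consisting of the edges of color $i$. A hypergraph is connected if it has only one vertex or any two distinct vertices can be connected by a sequence of edges each intersecting the next; every hypergraph is uniquely partitioned into connected components. A monochromatic component of $H$ is (the vertex set of) a connected component of $H_i$ for some color $i$. Let $c(H)$ be the minimum integer $m$ such that $V(H)$ can be covered by $m$ monochromatic components of $H$. $\mathrm{cov}(r,k)$ is the maximum of $c(K)$ when $K$ ranges over all spanning $k$-colorings of complete $r$-uniform $r$-partite hypergraphs. -}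

module Defs where

open import Data.Fin using (Fin)
open import Data.Nat using (ℕ; _≤_; NonZero)
open import Data.Product using (Σ; _×_; _,_; proj₁; ∃-syntax)
open import Data.Sum using (_⊎_)
open import Relation.Binary.Construct.Closure.ReflexiveTransitive using (Star)
open import Relation.Binary.PropositionalEquality using (_≡_)
open import Relation.Nullary using (¬_)

-- A complete r-uniform r-partite hypergraph is determined by the (positive,
-- finite) sizes of its classes; the class Vᵢ is modelled by Fin (size i).
record CompletePartite (r : ℕ) : Set where
  field
    size     : Fin r → ℕ
    nonempty : ∀ i → NonZero (size i)

  Vertex : Set
  Vertex = Σ (Fin r) λ i → Fin (size i)

  -- An edge is the choice of one vertex in each class.
  Edge : Set
  Edge = (i : Fin r) → Fin (size i)

  _∈ₑ_ : Vertex → Edge → Set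
  (i , x) ∈ₑ e = e i ≡ x

-- Without function extensionality, two functions may select the same vertices
-- without being propositionally equal; `respects` makes the colour depend only
-- on the edge as a set of vertices.
record Coloring {r : ℕ} (K : CompletePartite r) (k : ℕ) : Set where
  open CompletePartite K
  field
    color    : Edge → Fin k
    respects : ∀ e f → (∀ i → e i ≡ f i) → color e ≡ color f

module _ {r k : ℕ} {K : CompletePartite r} (χ : Coloring K k) where
  open CompletePartite K
  open Coloring χ

  EdgeOf : Fin k → Set
  EdgeOf a = ∃[ e ] color e ≡ a

  -- `EdgeOf a` as a hypothesis says that the colour a is used.
  Spanning : Set
  Spanning = ∀ (v : Vertex) (a : Fin k) → EdgeOf a → ∃[ e ] (color e ≡ a × v ∈ₑ e)

  Intersects : (a : Fin k) → EdgeOf a → EdgeOf a → Set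
  Intersects a (e , _) (f , _) = ∃[ v ] (v ∈ₑ e × v ∈ₑ f)

  -- `Connected a u v`: u and v coincide, or are joined by a sequence of edges
  -- of colour a, each intersecting the next.
  Connected : Fin k → Vertex → Vertex → Set
  Connected a u v =
    u ≡ v ⊎
    (Σ (EdgeOf a) λ e → Σ (EdgeOf a) λ f →
      u ∈ₑ proj₁ e × Star (Intersects a) e f × v ∈ₑ proj₁ f)

  -- A monochromatic component is given by its colour and one of its vertices.
  MonoComponent : Set
  MonoComponent = Fin k × Vertex

  _∈ᶜ_ : Vertex → MonoComponent → Set
  v ∈ᶜ (a , u) = Connected a u v

  CoverableBy : ℕ → Set
  CoverableBy m = Σ (Fin m → MonoComponent) λ C → ∀ v → ∃[ j ] (v ∈ᶜ C j)

IsMinimum : (ℕ → Set) → ℕ → Set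
IsMinimum P m = P m × (∀ n → P n → m ≤ n)

IsMaximum : (ℕ → Set) → ℕ → Set
IsMaximum P m = P m × (∀ n → P n → n ≤ m)

-- `Isc χ m` means c(K) = m for K coloured by χ.
Isc : ∀ {r k} {K : CompletePartite r} → Coloring K k → ℕ → Set
Isc χ = IsMinimum (CoverableBy χ)

-- `Iscov r k m` means cov(r,k) = m.
Iscov : ℕ → ℕ → ℕ → Set
Iscov r k = IsMaximum λ m →
  Σ (CompletePartite r) λ K → Σ (Coloring K k) λ χ → Spanning χ × Isc χ m

-- The inequality cov(r,k) ≤ b.  The number cov(r,k) is a maximum
-- over infinitely many colourings, so it exists only classically: `maximum` says
-- this under a double negation, and `values` says constructively that each of
-- the numbers it is the maximum of exists and is at most b.
record CovAtMost (r k b : ℕ) : Set where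
  field
    values  : ∀ (K : CompletePartite r) (χ : Coloring K k) → Spanning χ →
              ∃[ m ] (Isc χ m × m ≤ b)
    maximum : ¬ ¬ (∃[ m ] (Iscov r k m × m ≤ b))

{-# OPTIONS --safe #-}

-- Fix vertices u, v in distinct classes. If they lie in distinct components in
-- r ∸ 2 colours, match these colours with the r ∸ 2 remaining classes and extend
-- {u, v} to an edge e whose vertex in the class matched with the colour c is in
-- a c-component other than those of u and v (if this fails, the two c-components
-- of u and v cover everything). Given a vertex w, replace the vertex of e in the
-- class of w by w: the colour of the new edge is not a matched one, and w lies in
-- the component of that colour shared by at least two of u, v and a third vertex
-- of e. So r + t ∸ (r ∸ 2) = t + 2 components suffice.
-- Otherwise u and v lie in common components in r ∸ 2 colours. If these do not
-- cover a vertex w, then w is separated from u and v in these colours, and the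
-- first case applies to w and whichever of u, v is in another class.
module Submission where

open import Data.Empty using (⊥)
open import Data.Fin using (Fin; zero; suc; _≟_; punchIn; punchOut)
open import Data.Fin.Properties
  using (suc-injective; punchIn-injective; punchInᵢ≢i; punchIn-punchOut; punchOut-injective;
         any?; all?; ¬∀⟶∃¬; ∀-cons)
open import Data.List using (List; []; _∷_; allFin; map; concatMap)
open import Data.List.Membership.Propositional using (_∈_)
open import Data.List.Membership.Propositional.Properties using (∈-allFin; ∈-map⁺; ∈-concatMap⁺)
open import Data.List.Relation.Unary.Any using (here; there) renaming (map to Any-map)
open import Data.Nat using (ℕ; zero; suc; _+_; _∸_; _≤_; z≤n; s≤s)
open import Data.Nat.Properties
  using (≤-refl; ≤-trans; ≤-antisym; ≤-reflexive; ≤∧≢⇒<; n≤0⇒n≡0; m≤n+m; m≤m+n;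
         n≤1+n; +-suc; +-comm; +-mono-≤)
open import Data.Product using (Σ; ∃; ∃-syntax; _×_; _,_; proj₁; proj₂; uncurry)
open import Data.Product.Properties using (≡-dec)
open import Data.Sum using (_⊎_; inj₁; inj₂; [_,_]′) renaming (map to Sum-map)
open import Function using (_∘_; case_of_)
open import Function.Definitions using (Injective)
open import Relation.Binary.Construct.Closure.ReflexiveTransitive using (Star; ε; _◅_; _◅◅_; reverse)
open import Relation.Binary.Definitions using (Transitive) renaming (Decidable to Decidable₂)
open import Relation.Binary.PropositionalEquality
  using (_≡_; _≢_; refl; sym; trans; cong; subst; subst₂; ≢-sym)
open import Relation.Nullary using (¬_; Dec; yes; no; contradiction)
open import Relation.Nullary.Decidable using (map′; _×-dec_; _⊎-dec_; ¬?)
open import Relation.Unary using (Decidable)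
open import Defs

-- Extremal elements of predicates on ℕ

minimum : ∀ {P : ℕ → Set} → Decidable P → ∀ m → P m → ∃ (IsMinimum P)
minimum P? zero pm = 0 , pm , λ _ _ → z≤n
minimum {P} P? (suc m) pm with P? 0
... | yes p0 = 0 , p0 , λ _ _ → z≤n
... | no ¬p0 with minimum (P? ∘ suc) m pm
...   | n , pn , least = suc n , pn , least′
  where
  least′ : ∀ i → P i → suc n ≤ i
  least′ zero    pi = contradiction pi ¬p0
  least′ (suc i) pi = s≤s (least i pi)

-- If `P b` holds then `b` is the maximum; otherwise the bound drops by one. The descent ends in a
-- contradiction, since the bound 0 forces the given witness to be 0.
¬¬maximum : ∀ {P : ℕ → Set} b → (∀ n → P n → n ≤ b) → ∃ P → ¬ ¬ ∃ (IsMaximum P)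
¬¬maximum {P} b bound (m , pm) none = none-at-bound λ pb → none (b , pb , bound)
  where
  none-at-bound : ¬ ¬ P b
  none-at-bound ¬pb = below b bound ¬pb
    where
    below : ∀ b → (∀ n → P n → n ≤ b) → ¬ P b → ⊥
    below zero    bound ¬pb = ¬pb (subst P (n≤0⇒n≡0 (bound m pm)) pm)
    below (suc b) bound ¬pb = ¬¬maximum b bound′ (m , pm) none
      where
      bound′ : ∀ n → P n → n ≤ b
      bound′ n pn with ≤∧≢⇒< (bound n pn) (λ { refl → ¬pb pn })
      ... | s≤s n≤b = n≤b

-- Finite sets and functions

-- Coordinates are searched one at a time. `ext` stands in for function extensionality: `f` rebuilt
-- from its head and tail agrees with `f` only pointwise.
∃Π? : ∀ {n} {B : Fin n → Set} →
      (∀ i {P : B i → Set} → Decidable P → Dec (∃ P)) →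
      {P : (∀ i → B i) → Set} → (∀ {f g} → (∀ i → f i ≡ g i) → P f → P g) →
      Decidable P → Dec (∃ P)
∃Π? {zero} {B} search ext P? =
  map′ (λ p → empty , p) (λ { (f , p) → ext (λ ()) p }) (P? empty)
  where
  empty : ∀ i → B i
  empty ()
∃Π? {suc n} {B} search {P} ext P? =
  map′ (λ { (x , f , p) → ∀-cons x f , p })
       (λ { (f , p) → f zero , f ∘ suc , ext (λ { zero → refl ; (suc i) → refl }) p })
       (search zero λ x → ∃Π? (search ∘ suc) (λ eq → ext λ { zero → refl ; (suc i) → eq i })
                              (λ f → P? (∀-cons x f)))

update : ∀ {n} {B : Fin n → Set} (e : ∀ i → B i) i (b : B i) →
         ∃[ e′ ] (e′ i ≡ b × (∀ j → i ≢ j → e′ j ≡ e j))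
update {B = B} e i b = e′ , at , off
  where
  e′ : ∀ j → B j
  e′ j with i ≟ j
  ... | yes refl = b
  ... | no  _    = e j
  at : e′ i ≡ b
  at with i ≟ i
  ... | yes refl = refl
  ... | no  i≢i  = contradiction refl i≢i
  off : ∀ j → i ≢ j → e′ j ≡ e j
  off j i≢j with i ≟ j
  ... | yes i≡j = contradiction i≡j i≢j
  ... | no  _   = refl

record Remaining {n} (p q : Fin (2 + n)) : Set where
  field
    at         : Fin n → Fin (2 + n)
    injective  : Injective _≡_ _≡_ at
    at≢p       : ∀ j → at j ≢ p
    at≢q       : ∀ j → at j ≢ q
    exhaustive : ∀ i → i ≡ p ⊎ i ≡ q ⊎ ∃[ j ] at j ≡ i

remaining : ∀ {n} {p q : Fin (2 + n)} → p ≢ q → Remaining p q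
remaining {n} {p} {q} p≢q = record
  { at         = at
  ; injective  = punchIn-injective _ _ _ ∘ punchIn-injective p _ _
  ; at≢p       = λ _ → punchInᵢ≢i p _
  ; at≢q       = λ j eq → punchInᵢ≢i q′ j
                   (punchIn-injective p _ _ (trans eq (sym (punchIn-punchOut p≢q))))
  ; exhaustive = exhaustive
  }
  where
  q′ : Fin (suc n)
  q′ = punchOut p≢q
  at : Fin n → Fin (2 + n)
  at j = punchIn p (punchIn q′ j)
  exhaustive : ∀ i → i ≡ p ⊎ i ≡ q ⊎ ∃[ j ] at j ≡ i
  exhaustive i with p ≟ i | q ≟ i
  ... | yes p≡i | _       = inj₁ (sym p≡i)
  ... | no  _   | yes q≡i = inj₂ (inj₁ (sym q≡i))
  ... | no  p≢i | no  q≢i =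
    inj₂ (inj₂ (punchOut q′≢i′ ,
                trans (cong (punchIn p) (punchIn-punchOut q′≢i′)) (punchIn-punchOut p≢i)))
    where
    q′≢i′ : q′ ≢ punchOut p≢i
    q′≢i′ = q≢i ∘ punchOut-injective p≢q p≢i

module _ {n} {p q : Fin (2 + n)} (p≢q : p ≢ q) (R : Remaining p q) where
  open Remaining R

  glue : {B : Fin (2 + n) → Set} (y : B p) (z : B q) (x : ∀ j → B (at j)) →
         ∃[ e ] (e p ≡ y × e q ≡ z × (∀ j → e (at j) ≡ x j))
  glue {B} y z x =
    (λ i → proj₁ (value i)) ,
    sym (proj₁ (proj₂ (value p)) refl) ,
    sym (proj₁ (proj₂ (proj₂ (value q))) refl) ,
    λ j → sym (proj₂ (proj₂ (proj₂ (value (at j)))) j refl)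
    where
    -- Quantifying over all proofs `h` lets the three specifications be read off at `refl`, without
    -- evaluating `exhaustive` again.
    Value : Fin (2 + n) → Set
    Value i = Σ (B i) λ b → ((h : p ≡ i) → subst B h y ≡ b) ×
                            ((h : q ≡ i) → subst B h z ≡ b) ×
                            (∀ j (h : at j ≡ i) → subst B h (x j) ≡ b)
    same : ∀ {j l} (h : at j ≡ at l) → j ≡ l → subst B h (x j) ≡ x l
    same refl refl = refl
    value : ∀ i → Value i
    value i with exhaustive i
    ... | inj₁ refl =
      y , (λ { refl → refl }) , (λ h → contradiction (sym h) p≢q) ,
      λ j h → contradiction h (at≢p j)
    ... | inj₂ (inj₁ refl) =
      z , (λ h → contradiction h p≢q) , (λ { refl → refl }) , λ j h → contradiction h (at≢q j)
    ... | inj₂ (inj₂ (l , refl)) =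
      x l , (λ h → contradiction (sym h) (at≢p l)) , (λ h → contradiction (sym h) (at≢q l)) ,
      λ j h → same h (injective h)

-- Each step punches `d zero` out of the colours and out of the remaining values of `d`; after `m`
-- steps `n` colours are left.
enumerate-complement : ∀ m {n k} → m + n ≡ k → (d : Fin m → Fin k) → Injective _≡_ _≡_ d →
  Σ (Fin n → Fin k) λ g → ∀ c → (∀ j → c ≢ d j) → ∃[ j ] g j ≡ c
enumerate-complement zero    refl d inj = (λ j → j) , λ c _ → c , refl
enumerate-complement (suc m) {n} refl d inj = punchIn (d zero) ∘ proj₁ rest , covers
  where
  d₀≢ : ∀ j → d zero ≢ d (suc j)
  d₀≢ j eq = case inj eq of λ ()
  rest : Σ (Fin n → Fin (m + n)) λ g → ∀ c → (∀ j → c ≢ punchOut (d₀≢ j)) → ∃[ j ] g j ≡ c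
  rest = enumerate-complement m refl (λ j → punchOut (d₀≢ j))
           (suc-injective ∘ inj ∘ punchOut-injective (d₀≢ _) (d₀≢ _))
  covers : ∀ c → (∀ j → c ≢ d j) → ∃[ j ] punchIn (d zero) (proj₁ rest j) ≡ c
  covers c c∉d = proj₁ hit , trans (cong (punchIn (d zero)) (proj₂ hit)) (punchIn-punchOut d₀≢c)
    where
    d₀≢c : d zero ≢ c
    d₀≢c = ≢-sym (c∉d zero)
    hit : ∃[ j ] proj₁ rest j ≡ punchOut d₀≢c
    hit = proj₂ rest (punchOut d₀≢c) λ j → c∉d (suc j) ∘ punchOut-injective d₀≢c (d₀≢ j)

InjectionInto : ∀ {k} → ℕ → (Fin k → Set) → Set
InjectionInto {k} a P = Σ (Fin a → Fin k) λ d → Injective _≡_ _≡_ d × (∀ j → P (d j))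

cons-injection : ∀ {k a} {P : Fin (suc k) → Set} → P zero →
                 InjectionInto a (P ∘ suc) → InjectionInto (suc a) P
cons-injection p₀ (d , inj , pd) =
  ∀-cons zero (suc ∘ d) ,
  (λ { {zero}  {zero}  _  → refl
     ; {suc _} {suc _} eq → cong suc (inj (suc-injective eq)) }) ,
  ∀-cons p₀ pd

suc-injection : ∀ {k a} {P : Fin (suc k) → Set} → InjectionInto a (P ∘ suc) → InjectionInto a P
suc-injection (d , inj , pd) = suc ∘ d , inj ∘ suc-injective , pd

-- For positive `a` and `b`, fewer than `a` indices inside `P` and fewer than `b` outside would give
-- `k + 2 ≤ a + b`. In the induction each index lowers `a` or `b` by one.
pigeonhole-split : ∀ {k} {P : Fin k → Set} → Decidable P → ∀ a b → a + b ≤ suc k →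
                   InjectionInto a P ⊎ InjectionInto b (¬_ ∘ P)
pigeonhole-split P? zero b _ = inj₁ ((λ ()) , (λ { {()} }) , λ ())
pigeonhole-split P? (suc a) zero _ = inj₂ ((λ ()) , (λ { {()} }) , λ ())
pigeonhole-split {zero} P? (suc a) (suc b) (s≤s le) with a + suc b | +-suc a b
pigeonhole-split {zero} P? (suc a) (suc b) (s≤s ()) | _ | refl
pigeonhole-split {suc k} {P} P? (suc a) (suc b) (s≤s le) with P? zero
... | yes p₀ =
  Sum-map (cons-injection {P = P} p₀) (suc-injection {P = ¬_ ∘ P})
    (pigeonhole-split (P? ∘ suc) a (suc b) le)
... | no ¬p₀ =
  Sum-map (suc-injection {P = P}) (cons-injection {P = ¬_ ∘ P} ¬p₀)
    (pigeonhole-split (P? ∘ suc) (suc a) b (≤-trans (≤-reflexive (sym (+-suc a b))) le))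

-- Decidability of reachability in a finite relation

module Warshall {A : Set} (R : A → A → Set) where

  -- Reachability through intermediate points in the list.
  Via : List A → A → A → Set
  Via []       u v = R u v
  Via (x ∷ xs) u v = Via xs u v ⊎ (Via xs u x × Via xs x v)

  via? : Decidable₂ R → ∀ xs → Decidable₂ (Via xs)
  via? R? []       u v = R? u v
  via? R? (x ∷ xs) u v = via? R? xs u v ⊎-dec (via? R? xs u x ×-dec via? R? xs x v)

  base : ∀ xs {u v} → R u v → Via xs u v
  base []       r = r
  base (x ∷ xs) r = inj₁ (base xs r)

  compose : ∀ {xs x u v} → x ∈ xs → Via xs u x → Via xs x v → Via xs u v
  compose {y ∷ xs} (here refl) ux xv = inj₂ (to-y ux , from-y xv)
    where
    -- A route ending at `y` can be cut at its first visit to `y`, and a route starting there at its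
    -- last.
    to-y : ∀ {u} → Via (y ∷ xs) u y → Via xs u y
    to-y = [ (λ uy → uy) , proj₁ ]′
    from-y : ∀ {v} → Via (y ∷ xs) y v → Via xs y v
    from-y = [ (λ yv → yv) , proj₂ ]′
  compose (there x∈) (inj₁ ux)        (inj₁ xv)        = inj₁ (compose x∈ ux xv)
  compose (there x∈) (inj₁ ux)        (inj₂ (xy , yv)) = inj₂ (compose x∈ ux xy , yv)
  compose (there x∈) (inj₂ (uy , yx)) (inj₁ xv)        = inj₂ (uy , compose x∈ yx xv)
  -- Both routes pass through the head `y` of the list; the detour from `y` to `x` and back is
  -- dropped.
  compose (there x∈) (inj₂ (uy , _))  (inj₂ (_ , yv))  = inj₂ (uy , yv)

  via⊆ : ∀ {S : A → A → Set} → (∀ {u v} → R u v → S u v) → Transitive S →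
         ∀ xs {u v} → Via xs u v → S u v
  via⊆ R⊆S S-trans []       r                = R⊆S r
  via⊆ R⊆S S-trans (x ∷ xs) (inj₁ uv)        = via⊆ R⊆S S-trans xs uv
  via⊆ R⊆S S-trans (x ∷ xs) (inj₂ (ux , xv)) =
    S-trans (via⊆ R⊆S S-trans xs ux) (via⊆ R⊆S S-trans xs xv)

-- Finiteness of the vertex set

module _ {r : ℕ} (K : CompletePartite r) where
  open CompletePartite K

  first-vertex : ∀ i → Fin (size i)
  first-vertex i with size i | nonempty i
  ... | suc _ | _ = zero

  vertex-cases : {P : Vertex → Set} → Decidable P → (∀ v → P v) ⊎ (∃[ v ] ¬ P v)
  vertex-cases {P} P? with all? (λ i → all? λ x → P? (i , x))
  ... | yes all = inj₁ (uncurry all)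
  ... | no ¬all with ¬∀⟶∃¬ _ _ (λ i → all? λ x → P? (i , x)) ¬all
  ...   | i , ¬allᵢ with ¬∀⟶∃¬ _ _ (λ x → P? (i , x)) ¬allᵢ
  ...     | x , ¬p = inj₂ ((i , x) , ¬p)

  vertices : List Vertex
  vertices = concatMap (λ i → map (i ,_) (allFin (size i))) (allFin r)

  ∈-vertices : ∀ v → v ∈ vertices
  ∈-vertices (i , x) =
    ∈-concatMap⁺ _ (Any-map (λ { refl → ∈-map⁺ (i ,_) (∈-allFin x) }) (∈-allFin i))

-- Monochromatic components: decidability, and two ways to cover

module _ {r k : ℕ} {K : CompletePartite r} (χ : Coloring K k) where
  open CompletePartite K
  open Coloring χ

  connected-sym : ∀ {a u v} → Connected χ a u v → Connected χ a v u
  connected-sym (inj₁ eq) = inj₁ (sym eq)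
  connected-sym (inj₂ (e , f , u∈e , path , v∈f)) =
    inj₂ (f , e , v∈f , reverse (λ { (w , w∈e , w∈f) → w , w∈f , w∈e }) path , u∈e)

  connected-trans : ∀ {a} → Transitive (Connected χ a)
  connected-trans (inj₁ refl) vw          = vw
  connected-trans uv          (inj₁ refl) = uv
  connected-trans (inj₂ (e , f , u∈e , p , v∈f)) (inj₂ (e′ , f′ , v∈e′ , p′ , w∈f′)) =
    inj₂ (e , f′ , u∈e , p ◅◅ (_ , v∈f , v∈e′) ◅ p′ , w∈f′)

  edge-connected : ∀ e i j → Connected χ (color e) (i , e i) (j , e j)
  edge-connected e i j = inj₂ ((e , refl) , (e , refl) , refl , ε , refl)

  -- With equality included, `Connected` is the transitive closure of this decidable relation, so
  -- Warshall's algorithm applies.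
  Joined : Fin k → Vertex → Vertex → Set
  Joined a u v = u ≡ v ⊎ ∃[ e ] (color e ≡ a × u ∈ₑ e × v ∈ₑ e)

  joined? : ∀ a → Decidable₂ (Joined a)
  joined? a u@(i , x) v@(j , y) =
    ≡-dec _≟_ _≟_ u v ⊎-dec
    ∃Π? (λ _ → any?)
        (λ { e≗f (ce , u∈ , v∈) → trans (sym (respects _ _ e≗f)) ce ,
                                  trans (sym (e≗f i)) u∈ , trans (sym (e≗f j)) v∈ })
        (λ e → (color e ≟ a) ×-dec (e i ≟ x) ×-dec (e j ≟ y))

  joined⇒connected : ∀ {a u v} → Joined a u v → Connected χ a u v
  joined⇒connected (inj₁ eq) = inj₁ eq
  joined⇒connected (inj₂ (e , ce , u∈e , v∈e)) = inj₂ ((e , ce) , (e , ce) , u∈e , ε , v∈e)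

  connected? : ∀ a → Decidable₂ (Connected χ a)
  connected? a u v =
    map′ (via⊆ joined⇒connected connected-trans vs) complete (via? (joined? a) vs u v)
    where
    open Warshall (Joined a)
    vs : List Vertex
    vs = vertices K
    walk : ∀ {u v e f} → u ∈ₑ proj₁ e → Star (Intersects χ a) e f → v ∈ₑ proj₁ f → Via vs u v
    walk {e = e , ce} u∈e ε v∈e = base vs (inj₂ (e , ce , u∈e , v∈e))
    -- Consecutive edges meet in `w`, so a path of edges is also a walk on vertices that stops at
    -- these meeting points.
    walk {e = e , ce} u∈e ((w , w∈e , w∈f) ◅ path) v∈g =
      compose (∈-vertices K w) (base vs (inj₂ (e , ce , u∈e , w∈e))) (walk w∈f path v∈g)
    complete : ∀ {u v} → Connected χ a u v → Via vs u v
    complete (inj₁ eq) = base vs (inj₁ eq)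
    complete (inj₂ (e , f , u∈e , path , v∈f)) = walk u∈e path v∈f

  -- A component is named by a colour, a class and a position in it, so the families of `m`
  -- components can be searched. This makes the minimum c(K) exist constructively.
  coverable? : Decidable (CoverableBy χ)
  coverable? m =
    ∃Π? (λ _ P? → map′ (λ { (a , i , x , p) → (a , i , x) , p })
                       (λ { ((a , i , x) , p) → a , i , x , p })
                       (any? λ a → any? λ i → any? λ x → P? (a , i , x)))
        (λ eq cov v → proj₁ (cov v) , subst (v ∈′_) (eq _) (proj₂ (cov v)))
        (λ C → [ yes , (λ { (v , ¬p) → no λ cov → ¬p (cov v) }) ]′
                 (vertex-cases K λ v → any? λ j → connected? (proj₁ (C j)) (proj₂ (C j)) v))
    where
    _∈′_ : Vertex → MonoComponent χ → Set
    _∈′_ = _∈ᶜ_ χ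

  -- The colour `d j` pairwise separates the vertices of `e` in three classes: `p`, `q` and the
  -- class `i` given for `j`. An edge differing from `e` in one class keeps two of them, so its
  -- colour is none of the `d j`.
  separating-edge-cover :
    ∀ {m n p q s} → m + n ≡ k → p ≢ q → s ≢ p → s ≢ q → (e : Edge) →
    let C = λ c i j → Connected χ c (i , e i) (j , e j) in
    (d : Fin m → Fin k) → Injective _≡_ _≡_ d →
    (∀ j → ¬ C (d j) p q) →
    (∀ j → ∃[ i ] (i ≢ p × i ≢ q × ¬ C (d j) p i × ¬ C (d j) q i)) →
    CoverableBy χ n
  separating-edge-cover {m} {n} {p} {q} {s} m+n≡k p≢q s≢p s≢q e d inj sep sep′ =
    (λ j → g j , majority (g j)) , cover
    where
    C : Fin k → Fin r → Fin r → Set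
    C c i j = Connected χ c (i , e i) (j , e j)

    g : Fin n → Fin k
    g = proj₁ (enumerate-complement m m+n≡k d inj)

    -- If the vertices of `e` in `p` and `q` share a `c`-component, one of them survives any
    -- replacement. If not, a new edge of colour `c` must have replaced one of these two, so the
    -- vertex in `s` survives.
    majority : Fin k → Vertex
    majority c with connected? c (p , e p) (q , e q)
    ... | yes _ = p , e p
    ... | no  _ = s , e s

    cover : ∀ w → ∃[ j ] Connected χ (g j) (majority (g j)) w
    cover w@(i , b) = proj₁ hit , subst (λ c → Connected χ c (majority c) w) (sym (proj₂ hit)) covered
      where
      e′ : Edge
      e′ = proj₁ (update e i b)
      c : Fin k
      c = color e′
      near : ∀ j → i ≢ j → Connected χ c (j , e j) w
      near j i≢j = subst₂ (λ y x → Connected χ c (j , y) (i , x))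
                          (proj₂ (proj₂ (update e i b)) j i≢j) (proj₁ (proj₂ (update e i b)))
                          (edge-connected e′ j i)
      near₂ : ∀ j l → i ≢ j → i ≢ l → C c j l
      near₂ j l i≢j i≢l = connected-trans (near j i≢j) (connected-sym (near l i≢l))

      unmatched : ∀ j → c ≢ d j
      unmatched j c≡dj with sep j | sep′ j
      ... | ¬pq | l , l≢p , l≢q , ¬pl , ¬ql rewrite sym c≡dj with i ≟ p | i ≟ q
      ...   | yes refl | _        = ¬ql (near₂ q l p≢q (≢-sym l≢p))
      ...   | no  _    | yes refl = ¬pl (near₂ p l (≢-sym p≢q) (≢-sym l≢q))
      ...   | no  i≢p  | no  i≢q  = ¬pq (near₂ p q i≢p i≢q)

      hit : ∃[ j ] g j ≡ c
      hit = proj₂ (enumerate-complement m m+n≡k d inj) c unmatched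

      covered : Connected χ c (majority c) w
      covered with connected? c (p , e p) (q , e q) | i ≟ p | i ≟ q
      ... | yes pq | yes refl | _        = connected-trans pq (near q p≢q)
      ... | yes _  | no  i≢p  | _        = near p i≢p
      ... | no  _  | yes refl | _        = near s (≢-sym s≢p)
      ... | no  _  | no  _    | yes refl = near s (≢-sym s≢q)
      ... | no ¬pq | no  i≢p  | no  i≢q  = contradiction (near₂ p q i≢p i≢q) ¬pq

  module _ (spanning : Spanning χ) where

    -- An edge of colour `c` through any given vertex meets the class `i`, all of which lies in the
    -- two components.
    two-component-cover : ∀ c u v {i} → proj₁ u ≢ i → proj₁ v ≢ i →
      (∀ x → Connected χ c u (i , x) ⊎ Connected χ c v (i , x)) → CoverableBy χ 2
    two-component-cover c u v {i} u∉i v∉i near =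
      component , cover
      where
      component : Fin 2 → MonoComponent χ
      component zero       = c , u
      component (suc zero) = c , v
      -- `spanning` applies to used colours only. A connection from outside class `i` into it is not
      -- an equality, so it contains an edge of colour `c`.
      used-by : ∀ {w x} → proj₁ w ≢ i → Connected χ c w (i , x) → EdgeOf χ c
      used-by w∉i (inj₁ refl) = contradiction refl w∉i
      used-by _   (inj₂ (e , _)) = e
      used : EdgeOf χ c
      used = [ used-by u∉i , used-by v∉i ]′ (near (first-vertex K i))
      cover : ∀ w → ∃[ j ] _∈ᶜ_ χ w (component j)
      cover w@(l , _) with spanning w c used
      cover w@(l , _) | e , refl , refl with near (e i)
      ... | inj₁ ui = zero     , connected-trans ui (edge-connected e i l)
      ... | inj₂ vi = suc zero , connected-trans vi (edge-connected e i l)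

-- The bound t + 2 for a single colouring

module _ {a t k : ℕ} {K : CompletePartite (3 + a)} (χ : Coloring K k) (spanning : Spanning χ)
         (colors : suc a + (t + 2) ≡ k) where
  open CompletePartite K

  -- Among `3 + a` classes, `suc a` remain beside those of `u` and `v` when these are distinct, so
  -- one index `j` serves to match separating colours with remaining classes.
  Separated : Vertex → Vertex → Set
  Separated u v = InjectionInto (suc a) λ c → ¬ Connected χ c u v

  Bounded : Set
  Bounded = ∃[ n ] (n ≤ t + 2 × CoverableBy χ n)

  separated-cover : ∀ {u v} → proj₁ u ≢ proj₁ v → Separated u v → Bounded
  separated-cover {u@(p , y)} {v@(q , z)} p≢q (d , inj , sep) =
    case all? far? of λ where
      (yes far) → t + 2 , ≤-refl , from-edge (proj₁ ∘ far) (proj₂ ∘ far)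
      (no ¬far) → 2 , m≤n+m 2 t , from-failure (¬∀⟶∃¬ _ _ far? ¬far)
    where
    R : Remaining p q
    R = remaining p≢q
    open Remaining R
    Far : ∀ j → Fin (size (at j)) → Set
    Far j x = ¬ Connected χ (d j) u (at j , x) × ¬ Connected χ (d j) v (at j , x)
    far? : ∀ j → Dec (∃ (Far j))
    far? j = any? λ x → ¬? (connected? χ _ _ _) ×-dec ¬? (connected? χ _ _ _)

    from-edge : (x : ∀ j → Fin (size (at j))) → (∀ j → Far j (x j)) → CoverableBy χ (t + 2)
    from-edge x far with glue p≢q R y z x
    ... | e , refl , refl , ex =
      -- The third class `s` is `at zero`, available because there are at least three classes.
      separating-edge-cover χ colors p≢q (at≢p zero) (at≢q zero) e d inj sep λ j →
        at j , at≢p j , at≢q j , subst (Far j) (sym (ex j)) (far j)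

    from-failure : ∃[ j ] ¬ ∃ (Far j) → CoverableBy χ 2
    from-failure (j , none) =
      two-component-cover χ spanning (d j) u v (≢-sym (at≢p j)) (≢-sym (at≢q j)) near
      where
      near : ∀ x → Connected χ (d j) u (at j , x) ⊎ Connected χ (d j) v (at j , x)
      near x with connected? χ (d j) u (at j , x) | connected? χ (d j) v (at j , x)
      ... | yes ux | _      = inj₁ ux
      ... | no _   | yes vx = inj₂ vx
      ... | no ¬ux | no ¬vx = contradiction (x , ¬ux , ¬vx) none

  joined-cover : ∀ u v → proj₁ u ≢ proj₁ v → suc a ≤ t + 2 →
                 InjectionInto (suc a) (λ c → Connected χ c u v) → Bounded
  joined-cover u v u≁v a<t+2 (d , inj , con) =
    [ (λ all → suc a , a<t+2 , (λ j → d j , u) , all) , (λ { (w , ¬w) → from-uncovered w ¬w }) ]′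
      (vertex-cases K λ w → any? λ j → connected? χ (d j) u w)
    where
    from-uncovered : ∀ w → ¬ (∃[ j ] Connected χ (d j) u w) → Bounded
    from-uncovered w ¬w with proj₁ u ≟ proj₁ w
    ... | no  u≁w = separated-cover u≁w (d , inj , λ j uw → ¬w (j , uw))
    -- Here `w` is in the class of `u`, so `v` takes over: for each `d j` it lies in the component
    -- of `u`, which misses `w`.
    ... | yes u∼w = separated-cover (u≁v ∘ trans u∼w ∘ sym)
                      (d , inj , λ j vw → ¬w (j , connected-trans χ (con j) vw))

  bounded-cover : suc a ≤ t + 2 → suc a + suc a ≤ suc k → Bounded
  bounded-cover a<t+2 2a≤k =
    [ joined-cover u v (λ ()) a<t+2 , separated-cover (λ ()) ]′
      (pigeonhole-split (λ c → connected? χ c u v) (suc a) (suc a) 2a≤k)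
    where
    u v : Vertex
    u = zero , first-vertex K zero
    v = suc zero , first-vertex K (suc zero)

-- From single colourings to cov(r,k)

minimum-unique : ∀ {P : ℕ → Set} {m n} → IsMinimum P m → IsMinimum P n → m ≡ n
minimum-unique (pm , m≤) (pn , n≤) = ≤-antisym (m≤ _ pn) (n≤ _ pm)

-- This hypergraph provides a spanning colouring for every `r`, so the set of values whose maximum
-- is sought is nonempty.
singletons : ∀ r → CompletePartite r
singletons r = record { size = λ _ → 1 ; nonempty = λ _ → _ }

monochromatic : ∀ {r k} → Coloring (singletons r) (suc k)
monochromatic = record { color = λ _ → zero ; respects = λ _ _ _ → refl }

monochromatic-spanning : ∀ {r k} → Spanning (monochromatic {r} {k})
monochromatic-spanning (i , zero) a (e , e∈a) = (λ _ → zero) , e∈a , refl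

covAtMost : ∀ {r k b} →
  (∀ (K : CompletePartite r) (χ : Coloring K (suc k)) → Spanning χ →
     ∃[ n ] (n ≤ b × CoverableBy χ n)) →
  CovAtMost r (suc k) b
covAtMost {r} {k} {b} covers = record { values = values ; maximum = maximum }
  where
  values : ∀ (K : CompletePartite r) (χ : Coloring K (suc k)) → Spanning χ →
           ∃[ m ] (Isc χ m × m ≤ b)
  values K χ spanning with covers K χ spanning
  ... | n , n≤b , cov with minimum (coverable? χ) n cov
  ...   | m , min = m , min , ≤-trans (proj₂ min n cov) n≤b

  Value : ℕ → Set
  Value m = Σ (CompletePartite r) λ K → Σ (Coloring K (suc k)) λ χ → Spanning χ × Isc χ m

  bound : ∀ m → Value m → m ≤ b
  bound m (K , χ , spanning , isc) with values K χ spanning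
  ... | n , isc′ , n≤b = subst (_≤ b) (minimum-unique isc′ isc) n≤b

  inhabited : ∃ Value
  inhabited with values (singletons r) monochromatic monochromatic-spanning
  ... | m , isc , _ = m , singletons r , monochromatic , monochromatic-spanning , isc

  maximum : ¬ ¬ (∃[ m ] (Iscov r (suc k) m × m ≤ b))
  maximum none = ¬¬maximum b bound inhabited λ { (m , max) → none (m , max , bound m (proj₁ max)) }

theorem2p6 : (r t : ℕ) → 2 ≤ r ∸ 1 → r ∸ 1 ≤ t → CovAtMost r (r + t) (t + 2)
theorem2p6 (suc (suc (suc a))) t (s≤s (s≤s z≤n)) 2+a≤t =
  covAtMost λ K χ spanning → bounded-cover χ spanning colors (≤-trans 1+a≤t (m≤m+n t 2)) (double 1+a≤t)
  where
  1+a≤t : suc a ≤ t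
  1+a≤t = ≤-trans (n≤1+n (suc a)) 2+a≤t
  colors : suc a + (t + 2) ≡ 3 + a + t
  colors = cong suc (trans (cong (a +_) (+-comm t 2))
                           (trans (+-suc a (suc t)) (cong suc (+-suc a t))))
  -- The pigeonhole step asks that twice `r ∸ 2` be at most one more than the number `r + t` of
  -- colours.
  double : suc a ≤ t → suc a + suc a ≤ suc (3 + a + t)
  double le = ≤-trans (+-mono-≤ (≤-refl {suc a}) le) (m≤n+m (suc a + t) 3)
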